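{- There is an algorithm that, given a semi-permutation instance $X$ of Min-Sat in reduced form and a partitioning tree $T$ for it, produces a feasible $T$-special solution of cost at most $2|X|\cdot\mathrm{height}(T)$, in time polynomial in $|X|$.
   Context: Points have integer coordinates. Two points are collinear if they share an $x$- or $y$-coordinate; for non-collinear $p,q$, $\square_{p,q}$ is the smallest closed axis-parallel rectangle containing both; the pair is satisfied in $S$ if some $r\in S\setminus\{p,q\}$ lies in $\square_{p,q}$; $S$ is satisfied if all its non-collinear pairs are. A row (column) is active for $X$ if it contains a point of $X$. $X$ is a semi-permutation if each active row contains exactly one point. A feasible solution is $Y$ with $X\cup Y$ satisfied, of cost $|Y|$. Writing $X=\{p_1,\dots,p_m\}$ with increasing $y$, $p_i$ is redundant if $p_{i-1}.x=p_i.x=p_{i+1}.x$; $X$ is in reduced form if no point is redundant. Partitioning tree: with $\mathcal L$ the vertical lines with half-integral $x$-coordinate strictly between the minimum and maximum $x$-coordinates of $X$, a partitioning tree is a rooted binary tree whose vertices $v$ carry closed vertical strips $S(v)$, the root carrying the bounding box of $X$, each internal vertex $v$ owning a line $L(v)\in\mathcal L$ strictly inside $S(v)$ with its two children carrying the two strips into which $L(v)$ splits $S(v)$, and each leaf strip containing exactly one active column. $\mathrm{height}(T)$ is the maximum distance from the root to a vertex. A solution $Y$ is $T$-special if every point of $Y$ lies on a row active for $X$ and on a vertical line that is a boundary of $S(v)$ for some $v\in V(T)$. -}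

module Defs where

open import Data.Fin using (Fin)
open import Data.Integer using (ℤ; +_; _+_; _-_; _*_; _≤_; _<_; _⊓_; _⊔_)
open import Data.Integer.Properties using (<⇒≱)
open import Data.List using (List; []; _∷_; _++_)
open import Data.List.Membership.Propositional using (_∈_)
open import Data.List.Relation.Binary.Permutation.Propositional using (_↭_)
open import Data.List.Relation.Unary.Linked using (Linked)
open import Data.List.Relation.Unary.Unique.Propositional using (Unique)
import Data.Nat as ℕ
open import Data.Nat using (ℕ; suc)
open import Data.Product using (∃-syntax; ∃₂; _×_; _,_)
open import Data.Sum using (_⊎_)
open import Data.Tree.Binary using (Tree; leaf; node)
open import Data.Vec using (Vec; []; _∷_; lookup)
open import Relation.Binary.PropositionalEquality using (_≡_; _≢_; refl)
open import Relation.Nullary using (¬_; contradiction)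

-- Solutions live on vertical lines with half-integral abscissa, so every
-- abscissa (of points and of vertical lines alike) is an integer counting units
-- of ½: the number a stands for a/2. Ordinates are plain integers.

record Point : Set where
  constructor ⟨_,_⟩
  field
    x y : ℤ

open Point public

Integral HalfIntegral : ℤ → Set
Integral     a = ∃[ k ] a ≡ + 2 * k
HalfIntegral a = ∃[ k ] a ≡ + 2 * k + + 1

Collinear : Point → Point → Set
Collinear p q = x p ≡ x q ⊎ y p ≡ y q

_∈□[_,_] : Point → Point → Point → Set
r ∈□[ p , q ] =
  (x p ⊓ x q ≤ x r × x r ≤ x p ⊔ x q) × (y p ⊓ y q ≤ y r × y r ≤ y p ⊔ y q)

SatisfiedPair : List Point → Point → Point → Set
SatisfiedPair S p q = ∃[ r ] r ∈ S × r ≢ p × r ≢ q × r ∈□[ p , q ]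

Satisfied : List Point → Set
Satisfied S = ∀ p q → p ∈ S → q ∈ S → ¬ Collinear p q → SatisfiedPair S p q

-- Finite point sets are duplicate-free lists, so that length is cardinality.
-- The order of the list carries no meaning.

record SemiPermutation (X : List Point) : Set where
  field
    isSet     : Unique X
    integral  : ∀ p → p ∈ X → Integral (x p)
    onePerRow : ∀ p q → p ∈ X → q ∈ X → y p ≡ y q → p ≡ q

Feasible : List Point → List Point → Set
Feasible X Y = Satisfied (X ++ Y)

_EnumeratesByY_ : List Point → List Point → Set
ps EnumeratesByY X = ps ↭ X × Linked (λ p q → y p < y q) ps

Redundant : List Point → Point → Set
Redundant X q =
  ∃₂ λ before after → ∃₂ λ p r →
    (before ++ p ∷ q ∷ r ∷ after) EnumeratesByY X × x p ≡ x q × x q ≡ x r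

Reduced : List Point → Set
Reduced X = ∀ q → q ∈ X → ¬ Redundant X q

-- Closed vertical strips. The vertical extent is never consulted, so the
-- bounding box of X is represented by its horizontal extent.

record Strip : Set where
  constructor [_,_]
  field
    left right : ℤ

open Strip public

_InStrip_ : ℤ → Strip → Set
a InStrip S = left S ≤ a × a ≤ right S

IsMinX IsMaxX : List Point → ℤ → Set
IsMinX X a = (∃[ p ] p ∈ X × x p ≡ a) × (∀ p → p ∈ X → a ≤ x p)
IsMaxX X a = (∃[ p ] p ∈ X × x p ≡ a) × (∀ p → p ∈ X → x p ≤ a)

IsBoundingStrip : List Point → Strip → Set
IsBoundingStrip X S = IsMinX X (left S) × IsMaxX X (right S)

ActiveColumn ActiveRow : List Point → ℤ → Set
ActiveColumn X a = ∃[ p ] p ∈ X × x p ≡ a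
ActiveRow    X b = ∃[ p ] p ∈ X × y p ≡ b

OneActiveColumn : List Point → Strip → Set
OneActiveColumn X S =
  ∃[ a ] (ActiveColumn X a × a InStrip S)
       × (∀ b → ActiveColumn X b → b InStrip S → b ≡ a)

_∈𝓛_ : ℤ → List Point → Set
ℓ ∈𝓛 X = HalfIntegral ℓ × (∃₂ λ a b → IsMinX X a × IsMaxX X b × a < ℓ × ℓ < b)

-- An internal vertex v is labelled by S(v) and L(v), a leaf v by S(v).

StripTree : Set
StripTree = Tree (Strip × ℤ) Strip

stripOf : StripTree → Strip
stripOf (leaf S)           = S
stripOf (node _ (S , _) _) = S

WellSplit : List Point → StripTree → Set
WellSplit X (leaf S)           = OneActiveColumn X S
WellSplit X (node l (S , ℓ) r) =
  ℓ ∈𝓛 X × (left S < ℓ × ℓ < right S)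
  × stripOf l ≡ [ left S , ℓ ] × stripOf r ≡ [ ℓ , right S ]
  × WellSplit X l × WellSplit X r

PartitioningTree : List Point → StripTree → Set
PartitioningTree X T = IsBoundingStrip X (stripOf T) × WellSplit X T

height : StripTree → ℕ
height (leaf _)     = 0
height (node l _ r) = suc (height l ℕ.⊔ height r)

strips : StripTree → List Strip
strips (leaf S)           = S ∷ []
strips (node l (S , _) r) = S ∷ strips l ++ strips r

Special : List Point → StripTree → List Point → Set
Special X T Y =
  ∀ p → p ∈ Y →
    ActiveRow X (y p) × (∃[ S ] S ∈ strips T × (x p ≡ left S ⊎ x p ≡ right S))

-- Algorithms are programs of a first-order call-by-value language over binary
-- trees with integer atoms. Every evaluation rule has unit cost: comparison,
-- addition and subtraction of integers are single steps, as usual for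
-- coordinates, and there is no multiplication. Trees are only built, taken apart
-- one level at a time and passed by reference, so each rule is a constant number
-- of steps of a pointer machine (the number of variables being fixed by the
-- program).

infixr 5 _∙_

data Val : Set where
  nil : Val
  int : ℤ → Val
  _∙_ : Val → Val → Val

-- Expressions over f function symbols (all unary) and n de Bruijn variables.

data Exp (f n : ℕ) : Set where
  var        : Fin n → Exp f n
  nil        : Exp f n
  int        : ℤ → Exp f n
  _∙_        : Exp f n → Exp f n → Exp f n
  add sub    : Exp f n → Exp f n → Exp f n
  bind       : Exp f n → Exp f (suc n) → Exp f n
  case       : Exp f n → Exp f n → Exp f (suc (suc n)) → Exp f n
  if_⊴_then_else_ : Exp f n → Exp f n → Exp f n → Exp f n → Exp f n
  call       : Fin f → Exp f n → Exp f n

record Program : Set where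
  field
    {size} : ℕ
    bodies : Vec (Exp size 1) size
    main   : Exp size 1

-- bs , ρ ⊢ e ⇓ v [ t ]: in environment ρ, with function bodies bs, the
-- expression e evaluates to v in t steps.

infix 4 _,_⊢_⇓_[_]

data _,_⊢_⇓_[_] {f n} (bs : Vec (Exp f 1) f) (ρ : Vec Val n) :
                Exp f n → Val → ℕ → Set where
  ⇓var  : ∀ {i} → bs , ρ ⊢ var i ⇓ lookup ρ i [ 1 ]
  ⇓nil  : bs , ρ ⊢ nil ⇓ nil [ 1 ]
  ⇓int  : ∀ {i} → bs , ρ ⊢ int i ⇓ int i [ 1 ]
  ⇓pair : ∀ {d e v w s t} →
          bs , ρ ⊢ d ⇓ v [ s ] → bs , ρ ⊢ e ⇓ w [ t ] →
          bs , ρ ⊢ d ∙ e ⇓ v ∙ w [ suc (s ℕ.+ t) ]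
  ⇓add  : ∀ {d e i j s t} →
          bs , ρ ⊢ d ⇓ int i [ s ] → bs , ρ ⊢ e ⇓ int j [ t ] →
          bs , ρ ⊢ add d e ⇓ int (i + j) [ suc (s ℕ.+ t) ]
  ⇓sub  : ∀ {d e i j s t} →
          bs , ρ ⊢ d ⇓ int i [ s ] → bs , ρ ⊢ e ⇓ int j [ t ] →
          bs , ρ ⊢ sub d e ⇓ int (i - j) [ suc (s ℕ.+ t) ]
  ⇓bind : ∀ {d e v w s t} →
          bs , ρ ⊢ d ⇓ v [ s ] → bs , (v ∷ ρ) ⊢ e ⇓ w [ t ] →
          bs , ρ ⊢ bind d e ⇓ w [ suc (s ℕ.+ t) ]
  ⇓caseₙ : ∀ {c d e w s t} →
          bs , ρ ⊢ c ⇓ nil [ s ] → bs , ρ ⊢ d ⇓ w [ t ] →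
          bs , ρ ⊢ case c d e ⇓ w [ suc (s ℕ.+ t) ]
  ⇓caseₚ : ∀ {c d e u v w s t} →
          bs , ρ ⊢ c ⇓ u ∙ v [ s ] → bs , (u ∷ v ∷ ρ) ⊢ e ⇓ w [ t ] →
          bs , ρ ⊢ case c d e ⇓ w [ suc (s ℕ.+ t) ]
  ⇓then : ∀ {a b d e i j w r s t} →
          bs , ρ ⊢ a ⇓ int i [ r ] → bs , ρ ⊢ b ⇓ int j [ s ] → i ≤ j →
          bs , ρ ⊢ d ⇓ w [ t ] →
          bs , ρ ⊢ if a ⊴ b then d else e ⇓ w [ suc (r ℕ.+ s ℕ.+ t) ]
  ⇓else : ∀ {a b d e i j w r s t} →
          bs , ρ ⊢ a ⇓ int i [ r ] → bs , ρ ⊢ b ⇓ int j [ s ] → j < i →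
          bs , ρ ⊢ e ⇓ w [ t ] →
          bs , ρ ⊢ if a ⊴ b then d else e ⇓ w [ suc (r ℕ.+ s ℕ.+ t) ]
  ⇓call : ∀ {g e v w s t} →
          bs , ρ ⊢ e ⇓ v [ s ] → bs , (v ∷ []) ⊢ lookup bs g ⇓ w [ t ] →
          bs , ρ ⊢ call g e ⇓ w [ suc (s ℕ.+ t) ]

-- Result and running time are determined by the program and its input.

⇓-deterministic : ∀ {f n bs} {ρ : Vec Val n} {e : Exp f n} {v w s t} →
                  bs , ρ ⊢ e ⇓ v [ s ] → bs , ρ ⊢ e ⇓ w [ t ] → v ≡ w × s ≡ t
⇓-deterministic ⇓var ⇓var = refl , refl
⇓-deterministic ⇓nil ⇓nil = refl , refl
⇓-deterministic ⇓int ⇓int = refl , refl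
⇓-deterministic (⇓pair a b) (⇓pair a′ b′)
  with refl , refl ← ⇓-deterministic a a′ | refl , refl ← ⇓-deterministic b b′ = refl , refl
⇓-deterministic (⇓add a b) (⇓add a′ b′)
  with refl , refl ← ⇓-deterministic a a′ | refl , refl ← ⇓-deterministic b b′ = refl , refl
⇓-deterministic (⇓sub a b) (⇓sub a′ b′)
  with refl , refl ← ⇓-deterministic a a′ | refl , refl ← ⇓-deterministic b b′ = refl , refl
⇓-deterministic (⇓bind a b) (⇓bind a′ b′)
  with refl , refl ← ⇓-deterministic a a′
  with refl , refl ← ⇓-deterministic b b′ = refl , refl
⇓-deterministic (⇓caseₙ a b) (⇓caseₙ a′ b′)
  with refl , refl ← ⇓-deterministic a a′ | refl , refl ← ⇓-deterministic b b′ = refl , refl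
⇓-deterministic (⇓caseₙ a _) (⇓caseₚ a′ _) with () , _ ← ⇓-deterministic a a′
⇓-deterministic (⇓caseₚ a _) (⇓caseₙ a′ _) with () , _ ← ⇓-deterministic a a′
⇓-deterministic (⇓caseₚ a b) (⇓caseₚ a′ b′)
  with refl , refl ← ⇓-deterministic a a′
  with refl , refl ← ⇓-deterministic b b′ = refl , refl
⇓-deterministic (⇓then a b _ c) (⇓then a′ b′ _ c′)
  with refl , refl ← ⇓-deterministic a a′ | refl , refl ← ⇓-deterministic b b′
     | refl , refl ← ⇓-deterministic c c′ = refl , refl
⇓-deterministic (⇓then a b i≤j _) (⇓else a′ b′ j<i _)
  with refl , refl ← ⇓-deterministic a a′ | refl , refl ← ⇓-deterministic b b′
     = contradiction i≤j (<⇒≱ j<i)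
⇓-deterministic (⇓else a b j<i _) (⇓then a′ b′ i≤j _)
  with refl , refl ← ⇓-deterministic a a′ | refl , refl ← ⇓-deterministic b b′
     = contradiction i≤j (<⇒≱ j<i)
⇓-deterministic (⇓else a b _ c) (⇓else a′ b′ _ c′)
  with refl , refl ← ⇓-deterministic a a′ | refl , refl ← ⇓-deterministic b b′
     | refl , refl ← ⇓-deterministic c c′ = refl , refl
⇓-deterministic (⇓call a b) (⇓call a′ b′)
  with refl , refl ← ⇓-deterministic a a′
  with refl , refl ← ⇓-deterministic b b′ = refl , refl

_On_Returns_InTime_ : Program → Val → Val → ℕ → Set
P On v Returns w InTime t = bodies , (v ∷ []) ⊢ main ⇓ w [ t ]
  where open Program P

-- The first component of an encoded tree tells leaves (nil) from internal
-- vertices (a pair).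

encodePoints : List Point → Val
encodePoints []       = nil
encodePoints (p ∷ ps) = (int (x p) ∙ int (y p)) ∙ encodePoints ps

encodeStrip : Strip → Val
encodeStrip S = int (left S) ∙ int (right S)

encodeTree : StripTree → Val
encodeTree (leaf S)           = nil ∙ encodeStrip S
encodeTree (node l (S , ℓ) r) = (encodeStrip S ∙ int ℓ) ∙ encodeTree l ∙ encodeTree r

encodeInput : List Point → StripTree → Val
encodeInput X T = encodePoints X ∙ encodeTree T

{-# OPTIONS --safe #-}

-- At an internal vertex v, project onto L(v) every point of X lying in S(v).
-- Two points that are not collinear and not strictly on the same side of L(v)
-- are satisfied by one of the two corners on L(v), and otherwise both belong to
-- the instance of one child; at a leaf all points share a column. Each level of
-- the tree projects each point at most once, which gives |X| · height(T) points.
-- The strips of the two children of v both contain points of X, so the linear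
-- work at v is paid for by 2mn in (m + n)² = m² + n² + 2mn and the total time is
-- quadratic in |X|.

module Submission where

open import Defs
open import Data.Bool using (true; false)
open import Data.Fin using (#_)
import Data.Integer as ℤ
import Data.Integer.Properties as ℤ
import Data.Integer.Tactic.RingSolver as ℤ-solve
open import Data.Integer using (ℤ)
open import Data.List using (List; []; _∷_; _++_; length; map; filter)
open import Data.List.Membership.Propositional using (_∈_)
open import Data.List.Membership.Propositional.Properties
  using (∈-map⁺; ∈-map⁻; ∈-++⁺ˡ; ∈-++⁺ʳ; ∈-++⁻; ∈-filter⁺; ∈-filter⁻)
open import Data.List.Properties using (++-assoc; ++-identityʳ; length-++; length-map)
import Data.List.Relation.Unary.All as All
open import Data.List.Relation.Unary.AllPairs using (AllPairs; []; _∷_)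
import Data.List.Relation.Unary.AllPairs as AllPairs
import Data.List.Relation.Unary.AllPairs.Properties as AllPairs
open import Data.List.Relation.Unary.Any using (here; there)
open import Data.List.Relation.Unary.Unique.Propositional using (Unique)
import Data.List.Relation.Unary.Unique.Propositional.Properties as Unique
open import Data.Nat using (ℕ; suc; _+_; _*_; _^_; _⊔_; _≤_; z≤n; s≤s)
open import Data.Nat.Properties
open import Data.Nat.Tactic.RingSolver using (solve-∀)
open import Data.Product using (∃-syntax; _×_; _,_; proj₁; proj₂)
open import Data.Sum using (_⊎_; inj₁; inj₂; [_,_]′)
open import Data.Tree.Binary using (leaf; node)
open import Data.Vec using (Vec; []; _∷_)
open import Function using (_∘_; _$_)
open import Function.Bundles using (_⇔_; mk⇔; Equivalence)
open import Level using (Level)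
open import Relation.Binary.PropositionalEquality
  using (_≡_; _≢_; refl; sym; trans; cong; cong₂; subst; module ≡-Reasoning)
open import Relation.Nullary using (¬_; does; yes; no; contradiction)
open import Relation.Unary using (Pred; Decidable)
open import Relation.Unary.Properties using (∁?)

-- The solution and the split of an instance at a line

project : ℤ → List Point → List Point
project ℓ = map λ p → ⟨ ℓ , y p ⟩

below above : ℤ → List Point → List Point
below ℓ = filter λ p → x p ℤ.≤? ℓ
above ℓ = filter (∁? λ p → x p ℤ.≤? ℓ)

solution : StripTree → List Point → List Point
solution (leaf _)           X = []
solution (node l (_ , ℓ) r) X =
  project ℓ X ++ solution l (below ℓ X) ++ solution r (above ℓ X)

-- What the recursion needs to know about a well split tree and the points in
-- its strip. Leaves must have an active column, so that every subtree receives
-- a point and the size of the tree is bounded by that of the instance.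
Separates : StripTree → List Point → Set
Separates (leaf _)           X =
  ∃[ a ] ActiveColumn X a × (∀ b → ActiveColumn X b → b ≡ a)
Separates (node l (_ , ℓ) r) X =
  (∀ p → p ∈ solution l (below ℓ X) → x p ℤ.< ℓ)
  × (∀ p → p ∈ solution r (above ℓ X) → ℓ ℤ.< x p)
  × Separates l (below ℓ X) × Separates r (above ℓ X)

module _ {a p : Level} {A : Set a} {P : Pred A p} (P? : Decidable P) where

  length-filter-∁ : ∀ xs →
    length (filter P? xs) + length (filter (∁? P?) xs) ≡ length xs
  length-filter-∁ []       = refl
  length-filter-∁ (x ∷ xs) with ih ← length-filter-∁ xs | does (P? x)
  ... | true  = cong suc ih
  ... | false = trans (+-suc _ _) (cong suc ih)

length-below+above : ∀ ℓ X → length (below ℓ X) + length (above ℓ X) ≡ length X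
length-below+above ℓ = length-filter-∁ λ p → x p ℤ.≤? ℓ

-- Descending to the leftmost leaf is enough: its active column supplies a point, and the sets below
-- it only shrink. The time recurrence needs this for both halves of every split.
separates⇒nonempty : ∀ T {X} → Separates T X → 1 ≤ length X
separates⇒nonempty (leaf _)           (_ , (_ , here _ , _) , _)  = s≤s z≤n
separates⇒nonempty (leaf _)           (_ , (_ , there _ , _) , _) = s≤s z≤n
separates⇒nonempty (node l (_ , ℓ) r) {X} (_ , _ , sₗ , _) =
  ≤-trans (separates⇒nonempty l sₗ)
    (subst (length (below ℓ X) ≤_) (length-below+above ℓ X) (m≤m+n _ _))

-- Location of the solution points

∈-below⁺ : ∀ {ℓ X p} → p ∈ X → x p ℤ.≤ ℓ → p ∈ below ℓ X
∈-below⁺ {ℓ} = ∈-filter⁺ λ p → x p ℤ.≤? ℓ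

∈-below⁻ : ∀ {ℓ X p} → p ∈ below ℓ X → p ∈ X × x p ℤ.≤ ℓ
∈-below⁻ {ℓ} = ∈-filter⁻ λ p → x p ℤ.≤? ℓ

∈-above⁺ : ∀ {ℓ X p} → p ∈ X → ℓ ℤ.< x p → p ∈ above ℓ X
∈-above⁺ {ℓ} p∈X ℓ<p = ∈-filter⁺ (∁? λ p → x p ℤ.≤? ℓ) p∈X (ℤ.<⇒≱ ℓ<p)

∈-above⁻ : ∀ {ℓ X p} → p ∈ above ℓ X → p ∈ X × ℓ ℤ.< x p
∈-above⁻ {ℓ} p∈ with p∈X , p≰ℓ ← ∈-filter⁻ (∁? λ p → x p ℤ.≤? ℓ) p∈ = p∈X , ℤ.≰⇒> p≰ℓ

data SolutionPoint l ℓ r X p : Set where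
  on  : x p ≡ ℓ → ActiveRow X (y p) → SolutionPoint l ℓ r X p
  inˡ : p ∈ solution l (below ℓ X) → SolutionPoint l ℓ r X p
  inʳ : p ∈ solution r (above ℓ X) → SolutionPoint l ℓ r X p

∈-project⁺ : ∀ {ℓ X b} → ActiveRow X b → ⟨ ℓ , b ⟩ ∈ project ℓ X
∈-project⁺ (_ , p∈X , refl) = ∈-map⁺ _ p∈X

∈-project⁻ : ∀ {ℓ X p} → p ∈ project ℓ X → x p ≡ ℓ × ActiveRow X (y p)
∈-project⁻ p∈ with q , q∈X , refl ← ∈-map⁻ _ p∈ = refl , q , q∈X , refl

solutionPoint : ∀ l ℓ r X {p} →
  p ∈ project ℓ X ++ solution l (below ℓ X) ++ solution r (above ℓ X) →
  SolutionPoint l ℓ r X p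
solutionPoint l ℓ r X p∈ with ∈-++⁻ (project ℓ X) p∈
... | inj₁ p∈ℓ with eq , row ← ∈-project⁻ {X = X} p∈ℓ = on eq row
... | inj₂ p∈lr = [ inˡ , inʳ ]′ (∈-++⁻ (solution l (below ℓ X)) p∈lr)

solution-activeRow : ∀ T {X p} → p ∈ solution T X → ActiveRow X (y p)
solution-activeRow (node l (_ , ℓ) r) {X} p∈ with solutionPoint l ℓ r X p∈
... | on _ row  = row
... | inˡ p∈l  with q , q∈ , eq ← solution-activeRow l p∈l = q , proj₁ (∈-below⁻ q∈) , eq
... | inʳ p∈r with q , q∈ , eq ← solution-activeRow r p∈r = q , proj₁ (∈-above⁻ q∈) , eq

stripOf∈strips : ∀ T → stripOf T ∈ strips T
stripOf∈strips (leaf _)     = here refl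
stripOf∈strips (node _ _ _) = here refl

-- `Z` is separate from `X` because the recursion shrinks the points while `WellSplit` keeps
-- referring to the whole instance; abscissas of solution points are dictated by the tree alone.
solution-onBoundary : ∀ T {X Z p} → WellSplit X T → p ∈ solution T Z →
  ∃[ S ] S ∈ strips T × (x p ≡ left S ⊎ x p ≡ right S)
solution-onBoundary (node l (_ , ℓ) r) {Z = Z} (_ , _ , S≡l , _ , wl , wr) p∈
  with solutionPoint l ℓ r Z p∈
... | on eq _ =
  -- The splitting line is the right boundary of the left child's strip.
  stripOf l , there (∈-++⁺ˡ (stripOf∈strips l)) , inj₂ (trans eq (cong right (sym S≡l)))
... | inˡ p∈l  with S , S∈ , b ← solution-onBoundary l wl p∈l = S , there (∈-++⁺ˡ S∈) , b
... | inʳ p∈r with S , S∈ , b ← solution-onBoundary r wr p∈r =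
  S , there (∈-++⁺ʳ (strips l) S∈) , b

solution-inside : ∀ T {X Z p} → WellSplit X T → p ∈ solution T Z →
  left (stripOf T) ℤ.< x p × x p ℤ.< right (stripOf T)
solution-inside (node l (_ , ℓ) r) {Z = Z} (_ , (S<ℓ , ℓ<S) , Sl , Sr , wl , wr) p∈
  with solutionPoint l ℓ r Z p∈
... | on refl _ = S<ℓ , ℓ<S
... | inˡ p∈l  with solution-inside l wl p∈l
...   | inside rewrite Sl = proj₁ inside , ℤ.<-trans (proj₂ inside) ℓ<S
solution-inside (node l (_ , ℓ) r) {Z = Z} (_ , (S<ℓ , ℓ<S) , Sl , Sr , wl , wr) p∈
    | inʳ p∈r with solution-inside r wr p∈r
...   | inside rewrite Sr = ℤ.<-trans S<ℓ (proj₁ inside) , proj₂ inside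

-- Cost and absence of duplicates

length-solution : ∀ T X → length (solution T X) ≤ length X * height T
length-solution (leaf _)           X = z≤n
length-solution (node l (_ , ℓ) r) X = begin
  length (project ℓ X ++ A ++ B)          ≡⟨ length-++ (project ℓ X) ⟩
  length (project ℓ X) + length (A ++ B)  ≡⟨ cong₂ _+_ (length-map _ X) (length-++ A) ⟩
  n + (length A + length B)
    ≤⟨ +-monoʳ-≤ n (+-mono-≤ (length-solution l (below ℓ X)) (length-solution r (above ℓ X))) ⟩
  n + (nₗ * height l + nᵣ * height r)
    -- Charging both halves at the larger height lets their sizes recombine to `n`.
    ≤⟨ +-monoʳ-≤ n (+-mono-≤ (*-monoʳ-≤ nₗ (m≤m⊔n (height l) (height r)))
                             (*-monoʳ-≤ nᵣ (m≤n⊔m (height l) (height r)))) ⟩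
  n + (nₗ * h + nᵣ * h)                   ≡⟨ cong (n +_) (*-distribʳ-+ h nₗ nᵣ) ⟨
  n + (nₗ + nᵣ) * h                       ≡⟨ cong (λ k → n + k * h) (length-below+above ℓ X) ⟩
  n + n * h                               ≡⟨ *-suc n h ⟨
  n * suc h                               ∎
  where
  open ≤-Reasoning
  A B : List Point
  A = solution l (below ℓ X)
  B = solution r (above ℓ X)
  n nₗ nᵣ h : ℕ
  n  = length X
  nₗ = length (below ℓ X)
  nᵣ = length (above ℓ X)
  h  = height l ⊔ height r

-- Projection forgets abscissas, so it can merge distinct points but not distinct rows; the property
-- also passes to sublists.
DistinctRows : List Point → Set
DistinctRows = AllPairs λ p q → y p ≢ y q

distinctRows : ∀ {X} → Unique X →
  (∀ p q → p ∈ X → q ∈ X → y p ≡ y q → p ≡ q) → DistinctRows X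
distinctRows []        _   = []
distinctRows (p∉ ∷ u) inj =
  All.tabulate (λ q∈ eq → All.lookup p∉ q∈ (inj _ _ (here refl) (there q∈) eq))
  ∷ distinctRows u (λ p q p∈ q∈ → inj p q (there p∈) (there q∈))

solution-unique : ∀ T {X} → Separates T X → DistinctRows X → Unique (solution T X)
solution-unique (leaf _)           _ _ = []
solution-unique (node l (_ , ℓ) r) {X} (<ℓ , ℓ< , sₗ , sᵣ) rows =
  Unique.++⁺ (AllPairs.map⁺ (AllPairs.map (λ y≢ eq → y≢ (cong y eq)) rows))
    (Unique.++⁺ (solution-unique l sₗ (AllPairs.filter⁺ _ rows))
                (solution-unique r sᵣ (AllPairs.filter⁺ _ rows))
      λ (p∈l , p∈r) → ℤ.<-asym (<ℓ _ p∈l) (ℓ< _ p∈r))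
    λ (p∈ℓ , p∈lr) → off-ℓ (∈-++⁻ (solution l (below ℓ X)) p∈lr) (proj₁ (∈-project⁻ p∈ℓ))
  where
  off-ℓ : ∀ {p} → p ∈ solution l (below ℓ X) ⊎ p ∈ solution r (above ℓ X) → x p ≢ ℓ
  off-ℓ (inj₁ p∈l) eq = ℤ.<-irrefl eq (<ℓ _ p∈l)
  off-ℓ (inj₂ p∈r) eq = ℤ.<-irrefl (sym eq) (ℓ< _ p∈r)

-- Feasibility

module _ l S ℓ r X (sep : Separates (node l (S , ℓ) r) X) where

  private T = node l (S , ℓ) r

  restrict-left : ∀ {p} → p ∈ X ++ solution T X → x p ℤ.< ℓ →
    p ∈ below ℓ X ++ solution l (below ℓ X)
  restrict-left p∈ p<ℓ with ∈-++⁻ X p∈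
  ... | inj₁ p∈X = ∈-++⁺ˡ (∈-below⁺ p∈X (ℤ.<⇒≤ p<ℓ))
  ... | inj₂ p∈Y with solutionPoint l ℓ r X p∈Y
  ...   | on eq _   = contradiction p<ℓ (ℤ.<-irrefl eq)
  ...   | inˡ p∈l  = ∈-++⁺ʳ (below ℓ X) p∈l
  ...   | inʳ p∈r = contradiction p<ℓ (ℤ.<-asym (proj₁ (proj₂ sep) _ p∈r))

  restrict-right : ∀ {p} → p ∈ X ++ solution T X → ℓ ℤ.< x p →
    p ∈ above ℓ X ++ solution r (above ℓ X)
  restrict-right p∈ ℓ<p with ∈-++⁻ X p∈
  ... | inj₁ p∈X = ∈-++⁺ˡ (∈-above⁺ p∈X ℓ<p)
  ... | inj₂ p∈Y with solutionPoint l ℓ r X p∈Y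
  ...   | on eq _   = contradiction ℓ<p (ℤ.<-irrefl (sym eq))
  ...   | inˡ p∈l  = contradiction ℓ<p (ℤ.<-asym (proj₁ sep _ p∈l))
  ...   | inʳ p∈r = ∈-++⁺ʳ (above ℓ X) p∈r

activeRow : ∀ T X {p} → p ∈ X ++ solution T X → ActiveRow X (y p)
activeRow T X p∈ = [ (λ p∈X → _ , p∈X , refl) , solution-activeRow T ]′ (∈-++⁻ X p∈)

-- The point of `ℓ` in the row of `q` serves unless it is `q` itself. In that case `p` is off `ℓ`,
-- and the point in the row of `p` serves.
corner : ∀ {ℓ Y p q} → ⟨ ℓ , y p ⟩ ∈ Y → ⟨ ℓ , y q ⟩ ∈ Y → ¬ Collinear p q →
  x p ℤ.⊓ x q ℤ.≤ ℓ → ℓ ℤ.≤ x p ℤ.⊔ x q → SatisfiedPair Y p q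
corner {ℓ} {p = p} {q} ℓp∈ ℓq∈ ¬col lo hi with ℓ ℤ.≟ x q
... | no ℓ≢q =
  ⟨ ℓ , y q ⟩ , ℓq∈ , (λ eq → ¬col (inj₂ (sym (cong y eq)))) , (λ eq → ℓ≢q (cong x eq))
  , (lo , hi) , ℤ.i⊓j≤j (y p) (y q) , ℤ.i≤j⊔i (y p) (y q)
... | yes refl =
  ⟨ ℓ , y p ⟩ , ℓp∈ , (λ eq → ¬col (inj₁ (sym (cong x eq)))) , (λ eq → ¬col (inj₂ (cong y eq)))
  , (lo , hi) , ℤ.i⊓j≤i (y p) (y q) , ℤ.i≤i⊔j (y p) (y q)

satisfiedPair-mono : ∀ {Y Z p q} → (∀ {r} → r ∈ Y → r ∈ Z) →
  SatisfiedPair Y p q → SatisfiedPair Z p q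
satisfiedPair-mono Y⊆Z (r , r∈ , rest) = r , Y⊆Z r∈ , rest

-- The witness is drawn from the solution alone, so lifting it from a child only uses that the
-- child's solution is part of the parent's.
solution-satisfies : ∀ T X {p q} → Separates T X →
  p ∈ X ++ solution T X → q ∈ X ++ solution T X → ¬ Collinear p q →
  SatisfiedPair (solution T X) p q
solution-satisfies (leaf _) X (_ , _ , one) p∈ q∈ ¬col =
  contradiction (inj₁ (trans (column p∈) (sym (column q∈)))) ¬col
  where
  column : ∀ {p} → p ∈ X ++ [] → x p ≡ _
  column p∈ = one _ (_ , subst (_ ∈_) (++-identityʳ X) p∈ , refl)
solution-satisfies T@(node l (S , ℓ) r) X {p} {q} sep@(_ , _ , sₗ , sᵣ) p∈ q∈ ¬col
  with x p ℤ.⊔ x q ℤ.<? ℓ | ℓ ℤ.<? x p ℤ.⊓ x q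
... | yes <ℓ | _ =
  satisfiedPair-mono (∈-++⁺ʳ (project ℓ X) ∘ ∈-++⁺ˡ) $
  solution-satisfies l (below ℓ X) sₗ
    (restrict-left l S ℓ r X sep p∈ (ℤ.≤-<-trans (ℤ.i≤i⊔j (x p) (x q)) <ℓ))
    (restrict-left l S ℓ r X sep q∈ (ℤ.≤-<-trans (ℤ.i≤j⊔i (x p) (x q)) <ℓ)) ¬col
... | no _ | yes ℓ< =
  satisfiedPair-mono (∈-++⁺ʳ (project ℓ X) ∘ ∈-++⁺ʳ (solution l (below ℓ X))) $
  solution-satisfies r (above ℓ X) sᵣ
    (restrict-right l S ℓ r X sep p∈ (ℤ.<-≤-trans ℓ< (ℤ.i⊓j≤i (x p) (x q))))
    (restrict-right l S ℓ r X sep q∈ (ℤ.<-≤-trans ℓ< (ℤ.i⊓j≤j (x p) (x q)))) ¬col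
... | no ≮ℓ | no ℓ≮ =
  -- Now `ℓ` meets the rectangle. Added points lie on active rows as well, so both corners on `ℓ`
  -- are projections of points of `X`.
  corner (on-ℓ p∈) (on-ℓ q∈) ¬col (ℤ.≮⇒≥ ℓ≮) (ℤ.≮⇒≥ ≮ℓ)
  where
  on-ℓ : ∀ {p} → p ∈ X ++ solution T X → ⟨ ℓ , y p ⟩ ∈ solution T X
  on-ℓ p∈ = ∈-++⁺ˡ (∈-project⁺ (activeRow T X p∈))

-- From partitioning trees to separation

integral≢halfIntegral : ∀ {a b} → Integral a → HalfIntegral b → a ≢ b
integral≢halfIntegral (j , refl) (k , refl) eq =
  -- Taking absolute values moves the parity contradiction 2(j - k) = 1 to the naturals.
  even≢odd ℤ.∣ j ℤ.- k ∣ 0 (begin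
    2 * ℤ.∣ j ℤ.- k ∣                ≡⟨ ℤ.abs-* (ℤ.+ 2) (j ℤ.- k) ⟨
    ℤ.∣ ℤ.+ 2 ℤ.* (j ℤ.- k) ∣        ≡⟨ cong ℤ.∣_∣ (difference j k) ⟩
    ℤ.∣ ℤ.+ 2 ℤ.* j ℤ.- ℤ.+ 2 ℤ.* k ∣  ≡⟨ cong (λ i → ℤ.∣ i ℤ.- ℤ.+ 2 ℤ.* k ∣) eq ⟩
    ℤ.∣ ℤ.+ 2 ℤ.* k ℤ.+ ℤ.+ 1 ℤ.- ℤ.+ 2 ℤ.* k ∣  ≡⟨ cong ℤ.∣_∣ (cancel (ℤ.+ 2 ℤ.* k)) ⟩
    1                                ∎)
  where
  open ≡-Reasoning
  difference : ∀ j k → ℤ.+ 2 ℤ.* (j ℤ.- k) ≡ ℤ.+ 2 ℤ.* j ℤ.- ℤ.+ 2 ℤ.* k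
  difference = ℤ-solve.solve-∀
  cancel : ∀ i → i ℤ.+ ℤ.+ 1 ℤ.- i ≡ ℤ.+ 1
  cancel = ℤ-solve.solve-∀

Restriction : List Point → Strip → List Point → Set
Restriction X S Z = ∀ p → p ∈ Z ⇔ (p ∈ X × x p InStrip S)

module _ {X Z S ℓ} (Z-restricts : Restriction X S Z)
         (S<ℓ : left S ℤ.< ℓ) (ℓ<S : ℓ ℤ.< right S) where

  below-restriction : Restriction X [ left S , ℓ ] (below ℓ Z)
  below-restriction p = mk⇔
    (λ p∈ → let p∈Z , p≤ℓ = ∈-below⁻ p∈ ; p∈X , S≤p , _ = to p∈Z in p∈X , S≤p , p≤ℓ)
    (λ (p∈X , S≤p , p≤ℓ) →
      ∈-below⁺ (from (p∈X , S≤p , ℤ.≤-trans p≤ℓ (ℤ.<⇒≤ ℓ<S))) p≤ℓ)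
    where open Equivalence (Z-restricts p)

  -- Strips are closed but `above` is strict, so points on `ℓ` must be excluded; parity of the
  -- coordinates does that later.
  above-restriction : (∀ p → p ∈ X → x p ≢ ℓ) → Restriction X [ ℓ , right S ] (above ℓ Z)
  above-restriction off-ℓ p = mk⇔
    (λ p∈ → let p∈Z , ℓ<p = ∈-above⁻ p∈ ; p∈X , _ , p≤S = to p∈Z in p∈X , ℤ.<⇒≤ ℓ<p , p≤S)
    (λ (p∈X , ℓ≤p , p≤S) →
      ∈-above⁺ (from (p∈X , ℤ.≤-trans (ℤ.<⇒≤ S<ℓ) ℓ≤p , p≤S))
               (ℤ.≤∧≢⇒< ℓ≤p (off-ℓ p p∈X ∘ sym)))
    where open Equivalence (Z-restricts p)

wellSplit⇒separates : ∀ T {X Z} → (∀ p → p ∈ X → Integral (x p)) → WellSplit X T →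
  Restriction X (stripOf T) Z → Separates T Z
wellSplit⇒separates (leaf S) integral (a , ((p , p∈X , refl) , a∈S) , one) Z-restricts =
  a , (p , Equivalence.from (Z-restricts p) (p∈X , a∈S) , refl)
    , λ { _ (q , q∈Z , refl) → let q∈X , q∈S = Equivalence.to (Z-restricts q) q∈Z
                               in one _ (q , q∈X , refl) q∈S }
wellSplit⇒separates (node l (S , ℓ) r) {X} integral
  ((half , _) , (S<ℓ , ℓ<S) , Sl , Sr , wl , wr) Z-restricts =
    (λ p p∈ → subst (λ R → x p ℤ.< right R) Sl (proj₂ (solution-inside l wl p∈)))
  , (λ p p∈ → subst (λ R → left R ℤ.< x p) Sr (proj₁ (solution-inside r wr p∈)))
  , wellSplit⇒separates l integral wl
      (subst (λ R → Restriction X R _) (sym Sl) (below-restriction Z-restricts S<ℓ ℓ<S))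
  , wellSplit⇒separates r integral wr
      (subst (λ R → Restriction X R _) (sym Sr) (above-restriction Z-restricts S<ℓ ℓ<S
        (λ p p∈X → integral≢halfIntegral (integral p p∈X) half)))

boundingStrip-restriction : ∀ {X S} → IsBoundingStrip X S → Restriction X S X
boundingStrip-restriction ((_ , min) , (_ , max)) p =
  mk⇔ (λ p∈X → p∈X , min p p∈X , max p p∈X) proj₁

-- The program and its running time

-- Arguments are passed as ℓ ∙ X ∙ Z, ℓ ∙ X, ℓ ∙ X and T ∙ X ∙ Z respectively,
-- where Z accumulates the output: prepending to it avoids a program for _++_.
projectBody belowBody aboveBody solveBody : Exp 4 1

projectBody =
  case (var (# 0)) nil
  (case (var (# 1)) nil
  (case (var (# 0)) (var (# 1))
  (case (var (# 0)) nil
  ((var (# 6) ∙ var (# 1)) ∙ call (# 0) (var (# 6) ∙ var (# 3) ∙ var (# 5))))))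

belowBody =
  case (var (# 0)) nil
  (case (var (# 1)) nil
  (case (var (# 0)) nil
  (if var (# 0) ⊴ var (# 4)
   then (var (# 2) ∙ call (# 1) (var (# 4) ∙ var (# 3)))
   else call (# 1) (var (# 4) ∙ var (# 3)))))

aboveBody =
  case (var (# 0)) nil
  (case (var (# 1)) nil
  (case (var (# 0)) nil
  (if var (# 0) ⊴ var (# 4)
   then call (# 2) (var (# 4) ∙ var (# 3))
   else (var (# 2) ∙ call (# 2) (var (# 4) ∙ var (# 3))))))

solveBody =
  case (var (# 0)) nil
  (case (var (# 1)) nil
  (case (var (# 2)) nil
  (case (var (# 0)) (var (# 3))
  (case (var (# 3)) nil
  -- Variables 0, 1, 3, 6, 7 are now the left and right subtrees, the line, the points and the
  -- accumulator. The right subtree's output is the accumulator of the left one, whose output is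
  -- that of the projection.
  (call (# 0) (var (# 3) ∙ var (# 6) ∙
    call (# 3) (var (# 0) ∙ call (# 1) (var (# 3) ∙ var (# 6)) ∙
      call (# 3) (var (# 1) ∙ call (# 2) (var (# 3) ∙ var (# 6)) ∙ var (# 7)))))))))

bodies : Vec (Exp 4 1) 4
bodies = projectBody ∷ belowBody ∷ aboveBody ∷ solveBody ∷ []

main : Exp 4 1
main = case (var (# 0)) nil (call (# 3) (var (# 1) ∙ var (# 0) ∙ nil))

-- No branch depends on coordinates, so the count is exact. With 18 as the right factor, one more
-- point unfolds to 18 more steps definitionally.
⇓project : ∀ ℓ X {Z} →
  bodies , (int ℓ ∙ encodePoints X ∙ encodePoints Z) ∷ []
    ⊢ projectBody ⇓ encodePoints (project ℓ X ++ Z) [ length X * 18 + 7 ]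
⇓project ℓ []      = ⇓caseₚ ⇓var (⇓caseₚ ⇓var (⇓caseₙ ⇓var ⇓var))
⇓project ℓ (_ ∷ X) =
  ⇓caseₚ ⇓var (⇓caseₚ ⇓var (⇓caseₚ ⇓var (⇓caseₚ ⇓var
    (⇓pair (⇓pair ⇓var ⇓var)
           (⇓call (⇓pair ⇓var (⇓pair ⇓var ⇓var)) (⇓project ℓ X))))))

-- Only a bound, since the time depends on the data: a kept point costs 15 steps, a dropped one 13.
⇓below : ∀ ℓ X → ∃[ t ]
  bodies , (int ℓ ∙ encodePoints X) ∷ [] ⊢ belowBody ⇓ encodePoints (below ℓ X) [ t ]
  × t ≤ length X * 15 + 5
⇓below ℓ []      = _ , ⇓caseₚ ⇓var (⇓caseₙ ⇓var ⇓nil) , ≤-refl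
⇓below ℓ (p ∷ X) with x p ℤ.≤? ℓ | ⇓below ℓ X
... | yes p≤ℓ | t , d , t≤ =
  _ , ⇓caseₚ ⇓var (⇓caseₚ ⇓var (⇓caseₚ ⇓var (⇓then ⇓var ⇓var p≤ℓ
        (⇓pair ⇓var (⇓call (⇓pair ⇓var ⇓var) d)))))
    , +-monoʳ-≤ 15 t≤
... | no p≰ℓ | t , d , t≤ =
  _ , ⇓caseₚ ⇓var (⇓caseₚ ⇓var (⇓caseₚ ⇓var (⇓else ⇓var ⇓var (ℤ.≰⇒> p≰ℓ)
        (⇓call (⇓pair ⇓var ⇓var) d))))
    , +-mono-≤ (m≤m+n 13 2) t≤

⇓above : ∀ ℓ X → ∃[ t ]
  bodies , (int ℓ ∙ encodePoints X) ∷ [] ⊢ aboveBody ⇓ encodePoints (above ℓ X) [ t ]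
  × t ≤ length X * 15 + 5
⇓above ℓ []      = _ , ⇓caseₚ ⇓var (⇓caseₙ ⇓var ⇓nil) , ≤-refl
⇓above ℓ (p ∷ X) with x p ℤ.≤? ℓ | ⇓above ℓ X
... | yes p≤ℓ | t , d , t≤ =
  _ , ⇓caseₚ ⇓var (⇓caseₚ ⇓var (⇓caseₚ ⇓var (⇓then ⇓var ⇓var p≤ℓ
        (⇓call (⇓pair ⇓var ⇓var) d))))
    , +-mono-≤ (m≤m+n 13 2) t≤
... | no p≰ℓ | t , d , t≤ =
  _ , ⇓caseₚ ⇓var (⇓caseₚ ⇓var (⇓caseₚ ⇓var (⇓else ⇓var ⇓var (ℤ.≰⇒> p≰ℓ)
        (⇓pair ⇓var (⇓call (⇓pair ⇓var ⇓var) d)))))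
    , +-monoʳ-≤ 15 t≤

-- For m, n ≥ 1 one has m + n ≤ 2mn, hence c + kd ≤ (c + 2d)mn ≤ Kmn, which the cross term 2Kmn of
-- the square covers.
quadratic-superadditive : ∀ c d {K m n k} → c + d + d ≤ K →
  1 ≤ m → 1 ≤ n → m + n ≡ k → c + k * d + K * m ^ 2 + K * n ^ 2 ≤ K * k ^ 2
quadratic-superadditive c d {m = suc m} {suc n} c+2d≤K (s≤s _) (s≤s _) refl
  with m≤n⇒∃[o]m+o≡n c+2d≤K
... | e , refl = ≤-trans (m≤m+n _ _) (≤-reflexive (identity c d e m n))
  where
  -- The last summand on the left is the slack of the inequality.
  identity : ∀ c d e m n →
    let K = c + d + d + e ; m′ = 1 + m ; n′ = 1 + n in
    c + (m′ + n′) * d + K * (m′ * (m′ * 1)) + K * (n′ * (n′ * 1))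
      + (c + 2 * (d + e) + (m + n) * (2 * (c + e) + 3 * d) + 2 * (K * (m * n)))
    ≡ K * ((m′ + n′) * ((m′ + n′) * 1))
  identity = solve-∀

-- 49 + 48 |X| steps at a vertex, and 145 = 49 + 2 · 48.
⇓solve : ∀ T X Z → Separates T X → ∃[ t ]
  bodies , (encodeTree T ∙ encodePoints X ∙ encodePoints Z) ∷ []
    ⊢ solveBody ⇓ encodePoints (solution T X ++ Z) [ t ]
  × t ≤ 145 * length X ^ 2
⇓solve (leaf S) X Z s =
  _ , ⇓caseₚ ⇓var (⇓caseₚ ⇓var (⇓caseₚ ⇓var (⇓caseₙ ⇓var ⇓var)))
    -- A leaf takes 9 steps, and 9 ≤ 145 suffices because its instance is nonempty.
    , ≤-trans (m≤m+n 9 136) (*-monoʳ-≤ 145 (^-monoˡ-≤ 2 (separates⇒nonempty (leaf S) s)))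
⇓solve T@(node l′ (S , ℓ) r′) X Z (_ , _ , sₗ , sᵣ)
  with tᵣ , dᵣ , tᵣ≤ ← ⇓solve r′ (above ℓ X) Z sᵣ
  with tₗ , dₗ , tₗ≤ ← ⇓solve l′ (below ℓ X) (solution r′ (above ℓ X) ++ Z) sₗ
  with ta , da , ta≤ ← ⇓above ℓ X
  with tb , db , tb≤ ← ⇓below ℓ X
  = _ , subst (λ Y → bodies , (encodeTree T ∙ encodePoints X ∙ encodePoints Z) ∷ []
                       ⊢ solveBody ⇓ encodePoints Y [ _ ]) reassociate
      (⇓caseₚ ⇓var (⇓caseₚ ⇓var (⇓caseₚ ⇓var (⇓caseₚ ⇓var (⇓caseₚ ⇓var
        (⇓call (⇓pair ⇓var (⇓pair ⇓var
          (⇓call (⇓pair ⇓var (⇓pair (⇓call (⇓pair ⇓var ⇓var) db)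
            (⇓call (⇓pair ⇓var (⇓pair (⇓call (⇓pair ⇓var ⇓var) da) ⇓var)) dᵣ))) dₗ)))
          (⇓project ℓ X)))))))
      , bound tb≤ ta≤ tₗ≤ tᵣ≤
  where
  n nₗ nᵣ : ℕ
  n  = length X
  nₗ = length (below ℓ X)
  nᵣ = length (above ℓ X)

  -- The left-hand side has the shape in which the derivation delivers its step count.
  regroup : ∀ n b a l r →
    23 + (b + (8 + (a + 1) + r) + l + (n * 18 + 7)) ≡ 39 + n * 18 + (b + a) + l + r
  regroup = solve-∀

  collect : ∀ n l r →
    39 + n * 18 + ((n * 15 + 5) + (n * 15 + 5)) + l + r ≡ 49 + n * 48 + l + r
  collect = solve-∀

  bound : ∀ {b a l r} → b ≤ n * 15 + 5 → a ≤ n * 15 + 5 →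
    l ≤ 145 * nₗ ^ 2 → r ≤ 145 * nᵣ ^ 2 →
    23 + (b + (8 + (a + 1) + r) + l + (n * 18 + 7)) ≤ 145 * n ^ 2
  bound {b} {a} {l} {r} b≤ a≤ l≤ r≤ = begin
    23 + (b + (8 + (a + 1) + r) + l + (n * 18 + 7))
      ≡⟨ regroup n b a l r ⟩
    39 + n * 18 + (b + a) + l + r
      ≤⟨ +-mono-≤ (+-mono-≤ (+-monoʳ-≤ (39 + n * 18) (+-mono-≤ b≤ a≤)) l≤) r≤ ⟩
    39 + n * 18 + ((n * 15 + 5) + (n * 15 + 5)) + 145 * nₗ ^ 2 + 145 * nᵣ ^ 2
      ≡⟨ collect n (145 * nₗ ^ 2) (145 * nᵣ ^ 2) ⟩
    49 + n * 48 + 145 * nₗ ^ 2 + 145 * nᵣ ^ 2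
      ≤⟨ quadratic-superadditive 49 48 ≤-refl
           (separates⇒nonempty l′ sₗ) (separates⇒nonempty r′ sᵣ) (length-below+above ℓ X) ⟩
    145 * n ^ 2 ∎
    where open ≤-Reasoning

  A B : List Point
  A = solution l′ (below ℓ X)
  B = solution r′ (above ℓ X)

  reassociate : project ℓ X ++ A ++ B ++ Z ≡ (project ℓ X ++ A ++ B) ++ Z
  reassociate = trans (cong (project ℓ X ++_) (sym (++-assoc A B Z)))
                      (sym (++-assoc (project ℓ X) (A ++ B) Z))

theorem6p7 : ∃[ A ] ∃[ c ] ∃[ k ]
    ((X : List Point) (T : StripTree) →
    SemiPermutation X → Reduced X → PartitioningTree X T →
    ∃[ Y ] ∃[ t ]
    ( A On encodeInput X T Returns encodePoints Y InTime t
    × t ≤ c * length X ^ k + c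
    × Unique Y
    × Feasible X Y
    × Special X T Y
    × length Y ≤ 2 * length X * height T ))
theorem6p7 =
  record { bodies = bodies ; main = main } , 145 , 2 , λ X T semi _ (bounds , wellSplit) →
  let open SemiPermutation semi
      sep = wellSplit⇒separates T integral wellSplit (boundingStrip-restriction bounds)
      Y = solution T X
      t , evaluates , t≤ = ⇓solve T X [] sep
  in Y , _
   , ⇓caseₚ ⇓var (⇓call (⇓pair ⇓var (⇓pair ⇓var ⇓nil))
       (subst (λ Z → bodies , (encodeTree T ∙ encodePoints X ∙ nil) ∷ []
                 ⊢ solveBody ⇓ encodePoints Z [ t ])
              (++-identityʳ Y) evaluates))
   -- `main` itself adds 8 steps, absorbed by the additive constant 145.
   , ≤-trans (+-mono-≤ (m≤m+n 8 137) t≤) (≤-reflexive (+-comm 145 _))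
   , solution-unique T sep (distinctRows isSet onePerRow)
   , (λ p q p∈ q∈ ¬col → satisfiedPair-mono (∈-++⁺ʳ X) (solution-satisfies T X sep p∈ q∈ ¬col))
   , (λ p p∈ → solution-activeRow T p∈ , solution-onBoundary T wellSplit p∈)
   , ≤-trans (length-solution T X) (*-monoˡ-≤ (height T) (m≤m+n (length X) _))
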